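{- For every Korselt number ($KN$) $n$, $$r\le\frac{\sqrt{8n+1}+1}{4}\qquad\text{and}\qquad r\le\left\lceil\sqrt{\frac n2}\right\rceil,$$ with equality (in each of the two inequalities) if and only if $E=2$.
   Context: A Korselt number ($KN$) is an integer $n$ together with a factorisation $n=\prod_{i=1}^d p_i$, where $d\ge 3$ and $1<p_1<p_2<\dots<p_d$ are odd integers (not necessarily prime), such that $p_i-1$ divides $n-1$ for every $i$, and such that $E:=\dfrac{n/p_d-1}{p_d-1}$ (which is an integer by the divisibility condition) satisfies $E\ge 2$. Notation: $r:=p_d$. -}

module Defs where

open import Data.Fin.Base as Fin using (Fin; zero; suc; fromℕ)
open import Data.Integer.Base as ℤ using (ℤ; +_)
import Data.Integer.Properties as ℤ
open import Data.Nat.Base as ℕ using (ℕ; zero; suc)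
open import Data.Nat.Divisibility using (_∣_; _∤_; divides; divides-refl; ∣-refl; ∣-trans; m∣m*n; n∣m*n; ∣m+n∣m⇒∣n)
import Data.Nat.DivMod as ℕ
import Data.Nat.Properties as ℕ
open import Data.Product.Base using (∃-syntax; _×_; _,_; proj₁; proj₂)
open import Data.Rational.Base
open import Data.Rational.Properties
open import Data.Rational.Solver using (module +-*-Solver)
open import Data.Sum.Base using (_⊎_; inj₁; inj₂)
open import Data.Vec.Functional using (Vector; foldr)
open import Function.Base using (_∘_)
open import Relation.Binary.PropositionalEquality
open import Relation.Nullary using (¬_; yes; no; contradiction)

∏ : ∀ {d} → Vector ℕ d → ℕ
∏ = foldr ℕ._*_ 1

∣∏ : ∀ {d} (p : Vector ℕ d) i → p i ∣ ∏ p
∣∏ p zero    = m∣m*n _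
∣∏ p (suc i) = ∣-trans (∣∏ (p ∘ suc) i) (n∣m*n (p zero))

1≤∏ : ∀ {d} (p : Vector ℕ d) → (∀ i → 1 ℕ.≤ p i) → 1 ℕ.≤ ∏ p
1≤∏ {zero}  p 1≤p = ℕ.≤-refl
1≤∏ {suc d} p 1≤p = ℕ.*-mono-≤ (1≤p zero) (1≤∏ (p ∘ suc) (1≤p ∘ suc))

-- If r divides n, n ≥ 1 and r - 1 divides n - 1, then r - 1 divides n/r - 1.
r∸1∣n/r∸1 : ∀ {n r} .{{_ : ℕ.NonZero r}} → 1 ℕ.≤ n → r ∣ n → r ℕ.∸ 1 ∣ n ℕ.∸ 1 →
            r ℕ.∸ 1 ∣ n ℕ./ r ℕ.∸ 1
r∸1∣n/r∸1 {n} {suc s} () (divides zero refl) h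
r∸1∣n/r∸1 {n} {suc s} 1≤n (divides (suc q) refl) h
  = subst (λ t → s ∣ t ℕ.∸ 1) (sym (ℕ.m*n/n≡m (suc q) (suc s) {{_}}))
      (∣m+n∣m⇒∣n (subst (s ∣_) eq h) (n∣m*n (suc q)))
  where
  open ≡-Reasoning
  eq : s ℕ.+ q ℕ.* suc s ≡ suc q ℕ.* s ℕ.+ q
  eq = begin
    s ℕ.+ q ℕ.* suc s       ≡⟨ cong (s ℕ.+_) (ℕ.*-suc q s) ⟩
    s ℕ.+ (q ℕ.+ q ℕ.* s)   ≡⟨ cong (s ℕ.+_) (ℕ.+-comm q _) ⟩
    s ℕ.+ (q ℕ.* s ℕ.+ q)   ≡⟨ ℕ.+-assoc s _ q ⟨
    suc q ℕ.* s ℕ.+ q       ∎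

-- The factors p₁ < ⋯ < p_d are indexed by Fin d with d = suc d-1, so that the
-- last one is p (fromℕ d-1).  All factors exceed 1, hence everything is positive
-- and lives in ℕ; the truncated subtractions and divisions below are exact:
-- see r∣n and E-exact.
record KorseltNumber : Set where
  field
    n   : ℕ
    d-1 : ℕ

  d : ℕ
  d = suc d-1

  field
    p          : Vector ℕ d
    n≡∏p       : n ≡ ∏ p
    3≤d        : 3 ℕ.≤ d
    1<p        : ∀ i → 1 ℕ.< p i
    increasing : ∀ {i j} → i Fin.< j → p i ℕ.< p j
    odd        : ∀ i → 2 ∤ p i
    p∸1∣n∸1    : ∀ i → p i ℕ.∸ 1 ∣ n ℕ.∸ 1

  r : ℕ
  r = p (fromℕ d-1)

  instance
    r-nonZero : ℕ.NonZero r
    r-nonZero = ℕ.>-nonZero (ℕ.<-trans ℕ.z<s (1<p _))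

    r∸1-nonZero : ℕ.NonZero (r ℕ.∸ 1)
    r∸1-nonZero = ℕ.>-nonZero (ℕ.m<n⇒0<n∸m (1<p _))

  E : ℕ
  E = (n ℕ./ r ℕ.∸ 1) ℕ./ (r ℕ.∸ 1)

  field
    2≤E : 2 ℕ.≤ E

  r∣n : r ∣ n
  r∣n = subst (r ∣_) (sym n≡∏p) (∣∏ p (fromℕ d-1))

  1≤n : 1 ℕ.≤ n
  1≤n = subst (1 ℕ.≤_) (sym n≡∏p) (1≤∏ p (λ i → ℕ.<⇒≤ (1<p i)))

  E-exact : E ℕ.* (r ℕ.∸ 1) ≡ n ℕ./ r ℕ.∸ 1
  E-exact = ℕ.m/n*n≡m (r∸1∣n/r∸1 1≤n r∣n (p∸1∣n∸1 (fromℕ d-1)))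

-- Real numbers x as two-sided Dedekind cuts: L q means q < x, U q means x < q.
record ℝ : Set₁ where
  field
    L U         : ℚ → Set
    L-inhabited : ∃[ q ] L q
    U-inhabited : ∃[ q ] U q
    L-closed    : ∀ {p q} → p < q → L q → L p
    U-closed    : ∀ {p q} → p < q → U p → U q
    L-open      : ∀ {p} → L p → ∃[ q ] p < q × L q
    U-open      : ∀ {p} → U p → ∃[ q ] q < p × U q
    disjoint    : ∀ {q} → ¬ (L q × U q)
    located     : ∀ {p q} → p < q → L p ⊎ U q

open ℝ

infix 4 _≤ᵣ_ _≈ᵣ_

_≤ᵣ_ : ℝ → ℝ → Set
x ≤ᵣ y = ∀ q → L x q → L y q

_≈ᵣ_ : ℝ → ℝ → Set
x ≈ᵣ y = x ≤ᵣ y × y ≤ᵣ x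

private
  p-1<p : ∀ p → p - 1ℚ < p
  p-1<p p = subst (p - 1ℚ <_) (+-identityʳ p) (+-monoʳ-< p (negative⁻¹ (- 1ℚ)))

  p<p+1 : ∀ p → p < p + 1ℚ
  p<p+1 p = subst (_< p + 1ℚ) (+-identityʳ p) (+-monoʳ-< p (positive⁻¹ 1ℚ))

  p+c-c : ∀ p c → p + c - c ≡ p
  p+c-c p c = solve 2 (λ p c → p :+ c :- c := p) refl p c
    where open +-*-Solver

  p-c+c : ∀ p c → p - c + c ≡ p
  p-c+c p c = solve 2 (λ p c → p :- c :+ c := p) refl p c
    where open +-*-Solver

  0<* : ∀ {p q} → 0ℚ < p → 0ℚ < q → 0ℚ < p * q
  0<* {p} {q} 0<p 0<q = positive⁻¹ (p * q)
    {{pos*pos⇒pos p {{positive 0<p}} q {{positive 0<q}}}}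

  *-mono-<-0< : ∀ {p q} c → 0ℚ < c → p < q → p * c < q * c
  *-mono-<-0< c 0<c = *-monoˡ-<-pos c {{positive 0<c}}

  sq-mono-≤ : ∀ {p q} → 0ℚ ≤ p → p ≤ q → p * p ≤ q * q
  sq-mono-≤ {p} {q} 0≤p p≤q = ≤-trans
    (*-monoˡ-≤-nonNeg p {{nonNegative 0≤p}} p≤q)
    (*-monoʳ-≤-nonNeg q {{nonNegative (≤-trans 0≤p p≤q)}} p≤q)

  sq-mono-< : ∀ {p q} → 0ℚ ≤ p → p < q → p * p < q * q
  sq-mono-< {p} {q} 0≤p p<q = ≤-<-trans
    (*-monoˡ-≤-nonNeg p {{nonNegative 0≤p}} (<⇒≤ p<q))
    (*-mono-<-0< q (≤-<-trans 0≤p p<q) p<q)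

  0<q-p : ∀ {p q} → p < q → 0ℚ < q - p
  0<q-p {p} {q} p<q = subst (_< q - p) (+-inverseʳ p) (+-monoˡ-< (- p) p<q)

  p<p+q : ∀ {p q} → 0ℚ < q → p < p + q
  p<p+q {p} {q} 0<q = subst (_< p + q) (+-identityʳ p) (+-monoʳ-< p 0<q)

  recip : ∀ {p} → 0ℚ < p → ∃[ i ] 0ℚ < i × i * p ≡ 1ℚ
  recip {p} 0<p = 1/ p , positive⁻¹ (1/ p) {{1/pos⇒pos p}} , *-inverseˡ p
    where instance
      _ : Positive p
      _ = positive 0<p
      _ : NonZero p
      _ = pos⇒nonZero p

fromℚ : ℚ → ℝ
fromℚ a = record
  { L           = _< a
  ; U           = a <_
  ; L-inhabited = a - 1ℚ , p-1<p a
  ; U-inhabited = a + 1ℚ , p<p+1 a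
  ; L-closed    = <-trans
  ; U-closed    = λ p<q a<p → <-trans a<p p<q
  ; L-open      = <-dense
  ; U-open      = λ a<p → let q , a<q , q<p = <-dense a<p in q , q<p , a<q
  ; disjoint    = λ (q<a , a<q) → <-asym q<a a<q
  ; located     = loc
  }
  where
  loc : ∀ {p q} → p < q → p < a ⊎ a < q
  loc {p} p<q with p <? a
  ... | yes p<a = inj₁ p<a
  ... | no  p≮a = inj₂ (≤-<-trans (≮⇒≥ p≮a) p<q)

fromℤ : ℤ → ℝ
fromℤ z = fromℚ (z / 1)

fromℕᵣ : ℕ → ℝ
fromℕᵣ k = fromℤ (+ k)

infixl 6 _+ᵣ_
infixl 7 _/ᵣ_

_+ᵣ_ : ℝ → ℚ → ℝ
x +ᵣ c = record
  { L           = λ q → L x (q - c)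
  ; U           = λ q → U x (q - c)
  ; L-inhabited = let q , l = L-inhabited x in q + c , subst (L x) (sym (p+c-c q c)) l
  ; U-inhabited = let q , u = U-inhabited x in q + c , subst (U x) (sym (p+c-c q c)) u
  ; L-closed    = λ p<q → L-closed x (+-monoˡ-< (- c) p<q)
  ; U-closed    = λ p<q → U-closed x (+-monoˡ-< (- c) p<q)
  ; L-open      = λ {p} l → let q , p-c<q , l′ = L-open x l in
                    q + c
                  , subst (_< q + c) (p-c+c p c) (+-monoˡ-< c p-c<q)
                  , subst (L x) (sym (p+c-c q c)) l′
  ; U-open      = λ {p} u → let q , q<p-c , u′ = U-open x u in
                    q + c
                  , subst (q + c <_) (p-c+c p c) (+-monoˡ-< c q<p-c)
                  , subst (U x) (sym (p+c-c q c)) u′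
  ; disjoint    = disjoint x
  ; located     = λ p<q → located x (+-monoˡ-< (- c) p<q)
  }

_/ᵣ_ : ℝ → (c : ℚ) → .{{Positive c}} → ℝ
x /ᵣ c = record
  { L           = λ q → L x (q * c)
  ; U           = λ q → U x (q * c)
  ; L-inhabited = let q , l = L-inhabited x in q * i , subst (L x) (sym (cancel₁ q)) l
  ; U-inhabited = let q , u = U-inhabited x in q * i , subst (U x) (sym (cancel₁ q)) u
  ; L-closed    = λ p<q → L-closed x (*-monoˡ-<-pos c p<q)
  ; U-closed    = λ p<q → U-closed x (*-monoˡ-<-pos c p<q)
  ; L-open      = λ {p} l → let q , pc<q , l′ = L-open x l in
                    q * i
                  , subst (_< q * i) (cancel₂ p) (*-mono-<-0< i 0<i pc<q)
                  , subst (L x) (sym (cancel₁ q)) l′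
  ; U-open      = λ {p} u → let q , q<pc , u′ = U-open x u in
                    q * i
                  , subst (q * i <_) (cancel₂ p) (*-mono-<-0< i 0<i q<pc)
                  , subst (U x) (sym (cancel₁ q)) u′
  ; disjoint    = disjoint x
  ; located     = λ p<q → located x (*-monoˡ-<-pos c p<q)
  }
  where
  open ≡-Reasoning
  i    = proj₁ (recip (positive⁻¹ c))
  0<i  = proj₁ (proj₂ (recip (positive⁻¹ c)))
  ic≡1 = proj₂ (proj₂ (recip (positive⁻¹ c)))

  cancel₁ : ∀ q → q * i * c ≡ q
  cancel₁ q = begin
    q * i * c    ≡⟨ *-assoc q i c ⟩
    q * (i * c)  ≡⟨ cong (q *_) ic≡1 ⟩
    q * 1ℚ       ≡⟨ *-identityʳ q ⟩
    q            ∎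

  cancel₂ : ∀ q → q * c * i ≡ q
  cancel₂ q = begin
    q * c * i    ≡⟨ *-assoc q c i ⟩
    q * (c * i)  ≡⟨ cong (q *_) (trans (*-comm c i) ic≡1) ⟩
    q * 1ℚ       ≡⟨ *-identityʳ q ⟩
    q            ∎

private
  module Sqrt (a : ℚ) where
    open +-*-Solver

    Lo Up : ℚ → Set
    Lo q = q < 0ℚ ⊎ q * q < a
    Up q = 0ℚ < q × a < q * q

    Up-inhabited : ∃[ q ] Up q
    Up-inhabited with a <? 0ℚ
    ... | yes a<0 = 1ℚ , positive⁻¹ 1ℚ , <-trans a<0 (positive⁻¹ 1ℚ)
    ... | no  a≮0 = a + 1ℚ , 0<a+1 , a<[a+1]²
      where
      0<a+1 : 0ℚ < a + 1ℚ
      0<a+1 = ≤-<-trans (≮⇒≥ a≮0) (p<p+1 a)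

      a<[a+1]² : a < (a + 1ℚ) * (a + 1ℚ)
      a<[a+1]² = <-≤-trans (p<p+1 a)
        (subst (_≤ (a + 1ℚ) * (a + 1ℚ)) (*-identityˡ (a + 1ℚ))
          (*-monoʳ-≤-nonNeg (a + 1ℚ) {{nonNegative (<⇒≤ 0<a+1)}}
            (subst (_≤ a + 1ℚ) (+-identityˡ 1ℚ) (+-monoˡ-≤ 1ℚ (≮⇒≥ a≮0)))))

    Lo-closed : ∀ {p q} → p < q → Lo q → Lo p
    Lo-closed p<q (inj₁ q<0)  = inj₁ (<-trans p<q q<0)
    Lo-closed {p} p<q (inj₂ q²<a) with p <? 0ℚ
    ... | yes p<0 = inj₁ p<0
    ... | no  p≮0 = inj₂ (<-trans (sq-mono-< (≮⇒≥ p≮0) p<q) q²<a)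

    Up-closed : ∀ {p q} → p < q → Up p → Up q
    Up-closed p<q (0<p , a<p²) = <-trans 0<p p<q , <-trans a<p² (sq-mono-< (<⇒≤ 0<p) p<q)

    -- For 0 ≤ p and p² < a put c = a + 1 and q = (p c + a) / (p + c); then
    -- a - q² = (a - p²) (c² - a) / (p + c)².
    Lo-open : ∀ {p} → Lo p → ∃[ q ] p < q × Lo q
    Lo-open {p} (inj₁ p<0) = let q , p<q , q<0 = <-dense p<0 in q , p<q , inj₁ q<0
    Lo-open {p} (inj₂ p²<a) with p <? 0ℚ
    ... | yes p<0 = let q , p<q , q<0 = <-dense p<0 in q , p<q , inj₁ q<0
    ... | no  p≮0 = q , p<q , inj₂ q²<a
      where
      0≤p : 0ℚ ≤ p
      0≤p = ≮⇒≥ p≮0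
      0<a : 0ℚ < a
      0<a = ≤-<-trans (sq-mono-≤ ≤-refl 0≤p) p²<a
      c = a + 1ℚ
      s = p + c
      0<c : 0ℚ < c
      0<c = <-trans 0<a (p<p+1 a)
      0<s : 0ℚ < s
      0<s = +-mono-≤-< 0≤p 0<c
      i   = proj₁ (recip 0<s)
      0<i = proj₁ (proj₂ (recip 0<s))
      i*s = proj₂ (proj₂ (recip 0<s))
      q = (p * c + a) * i

      p<q : p < q
      p<q = subst (_< q) eq (*-mono-<-0< i 0<i (+-monoʳ-< (p * c) p²<a))
        where
        eq : (p * c + p * p) * i ≡ p
        eq = trans (solve 3 (λ p c i → (p :* c :+ p :* p) :* i := p :* (i :* (p :+ c))) refl p c i)
                   (trans (cong (p *_) i*s) (*-identityʳ p))

      0<c²-a : 0ℚ < c * c - a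
      0<c²-a = subst (0ℚ <_)
        (solve 1 (λ a → a :* a :+ (a :+ con 1ℚ) := (a :+ con 1ℚ) :* (a :+ con 1ℚ) :- a) refl a)
        (<-trans (0<* 0<a 0<a) (p<p+q 0<c))

      q²<a : q * q < a
      q²<a = subst₂ _<_
        (solve 2 (λ t i → t :* t :* (i :* i) := t :* i :* (t :* i)) refl (p * c + a) i)
        eq
        (*-mono-<-0< (i * i) (0<* 0<i 0<i)
          (p<p+q {(p * c + a) * (p * c + a)} (0<* (0<q-p p²<a) 0<c²-a)))
        where
        eq : ((p * c + a) * (p * c + a) + (a - p * p) * (c * c - a)) * (i * i) ≡ a
        eq = trans
          (solve 4 (λ a c i p →
            ((p :* c :+ a) :* (p :* c :+ a) :+ (a :- p :* p) :* (c :* c :- a)) :* (i :* i)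
            := a :* ((i :* (p :+ c)) :* (i :* (p :+ c)))) refl a c i p)
          (trans (cong (λ t → a * (t * t)) i*s) (*-identityʳ a))

    -- For 0 ≤ a, a Newton step q = (p² + a) / 2p.
    Up-open : ∀ {p} → Up p → ∃[ q ] q < p × Up q
    Up-open {p} (0<p , a<p²) with a <? 0ℚ
    ... | yes a<0 = let q , 0<q , q<p = <-dense 0<p in
                    q , q<p , 0<q , <-trans a<0 (0<* 0<q 0<q)
    ... | no  a≮0 = q , q<p , 0<* 0<t 0<i , a<q²
      where
      0<2p : 0ℚ < p + p
      0<2p = +-mono-< 0<p 0<p
      i    = proj₁ (recip 0<2p)
      0<i  = proj₁ (proj₂ (recip 0<2p))
      i*2p = proj₂ (proj₂ (recip 0<2p))
      t = p * p + a
      q = t * i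
      0<t : 0ℚ < t
      0<t = +-mono-<-≤ (0<* 0<p 0<p) (≮⇒≥ a≮0)

      q<p : q < p
      q<p = subst (q <_) eq (*-mono-<-0< i 0<i (+-monoʳ-< (p * p) a<p²))
        where
        eq : (p * p + p * p) * i ≡ p
        eq = trans (solve 2 (λ p i → (p :* p :+ p :* p) :* i := p :* (i :* (p :+ p))) refl p i)
                   (trans (cong (p *_) i*2p) (*-identityʳ p))

      a<q² : a < q * q
      a<q² = subst₂ _<_ eq₁ eq₂
        (*-mono-<-0< (i * i) (0<* 0<i 0<i)
          (p<p+q {a * ((p + p) * (p + p))} (0<* (0<q-p a<p²) (0<q-p a<p²))))
        where
        eq₁ : a * ((p + p) * (p + p)) * (i * i) ≡ a
        eq₁ = trans
          (solve 3 (λ a i p → a :* ((p :+ p) :* (p :+ p)) :* (i :* i)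
                              := a :* ((i :* (p :+ p)) :* (i :* (p :+ p)))) refl a i p)
          (trans (cong (λ t → a * (t * t)) i*2p) (*-identityʳ a))
        eq₂ : (a * ((p + p) * (p + p)) + (p * p - a) * (p * p - a)) * (i * i) ≡ q * q
        eq₂ = solve 3 (λ a i p →
          (a :* ((p :+ p) :* (p :+ p)) :+ (p :* p :- a) :* (p :* p :- a)) :* (i :* i)
          := (p :* p :+ a) :* i :* ((p :* p :+ a) :* i)) refl a i p

    Lo-Up-disjoint : ∀ {q} → ¬ (Lo q × Up q)
    Lo-Up-disjoint (inj₁ q<0  , 0<q , _)    = <-asym q<0 0<q
    Lo-Up-disjoint (inj₂ q²<a , _   , a<q²) = <-asym q²<a a<q²

    loc : ∀ {p q} → p < q → Lo p ⊎ Up q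
    loc {p} p<q with p <? 0ℚ | p * p <? a
    ... | yes p<0 | _        = inj₁ (inj₁ p<0)
    ... | no  _   | yes p²<a = inj₁ (inj₂ p²<a)
    ... | no  p≮0 | no  p²≮a =
      inj₂ (≤-<-trans (≮⇒≥ p≮0) p<q , ≤-<-trans (≮⇒≥ p²≮a) (sq-mono-< (≮⇒≥ p≮0) p<q))

-- The non-negative square root of a ≥ 0; for a < 0 this is the cut of 0.
√_ : ℚ → ℝ
√ a = record
  { L           = λ q → q < 0ℚ ⊎ q * q < a
  ; U           = λ q → 0ℚ < q × a < q * q
  ; L-inhabited = - 1ℚ , inj₁ (negative⁻¹ (- 1ℚ))
  ; U-inhabited = Up-inhabited
  ; L-closed    = Lo-closed
  ; U-closed    = Up-closed
  ; L-open      = Lo-open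
  ; U-open      = Up-open
  ; disjoint    = Lo-Up-disjoint
  ; located     = loc
  }
  where open Sqrt a

infix 8 √_

-- c = ⌈ x ⌉, the least integer that is at least x.  This is a relation because
-- the ceiling is not a computable function of a cut; it determines c.
IsCeiling : ℝ → ℤ → Set
IsCeiling x c = x ≤ᵣ fromℤ c × (∀ z → x ≤ᵣ fromℤ z → c ℤ.≤ z)

IsCeiling-unique : ∀ {x c c′} → IsCeiling x c → IsCeiling x c′ → c ≡ c′
IsCeiling-unique (x≤c , least) (x≤c′ , least′) = ℤ.≤-antisym (least _ x≤c′) (least′ _ x≤c)

{-# OPTIONS --safe #-}
-- Put r = p_d.  Since n = r (E (r - 1) + 1), one has
--   8n + 1 = (4r - 1)² + 8 (E - 2) r (r - 1),
-- which settles the first inequality, and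
--   2 (r - 1)² < n,  with  n ≤ 2r²  if E = 2  and  n > 2r²  if E ≥ 3  (as r ≥ 3),
-- which settles the second.
module Submission where

open import Defs
open import Data.Fin.Base using (fromℕ)
open import Data.Integer.Base as ℤ using (ℤ; +_; -[1+_])
import Data.Integer.Properties as ℤ
open import Data.Nat.Base as ℕ using (ℕ; zero; suc; z≤n; s≤s)
open import Data.Nat.Divisibility using (_∣_; ∣-refl)
import Data.Nat.DivMod as ℕ
import Data.Nat.Properties as ℕ
open import Data.Nat.Tactic.RingSolver using (solve-∀)
open import Data.Product.Base using (∃-syntax; _×_; _,_; proj₂)
open import Data.Rational.Base using (1ℚ; _/_; _<_; _*_; _+_; _-_; fromℚᵘ; toℚᵘ)
open import Data.Rational.Properties
import Data.Rational.Unnormalised.Base as ℚᵘ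
import Data.Rational.Unnormalised.Properties as ℚᵘ
open import Data.Sum.Base using (inj₁; inj₂)
open import Function.Base using (_∘_)
open import Function.Bundles using (_⇔_; mk⇔; Equivalence)
open import Relation.Binary.Definitions using (tri<; tri≈; tri>)
open import Relation.Binary.PropositionalEquality
open import Relation.Nullary using (¬_; yes; no; contradiction)
open import Relation.Unary using (Decidable)

open ℝ
open Equivalence using (to; from)

-- The source of the ceiling of `√ (+ n / 2)`: an integer test decides which naturals lie above this
-- root, so the smallest one can be searched for.
least : ∀ {P : ℕ → Set} → Decidable P → ∀ {m} → P m →
        ∃[ k ] P k × (∀ j → P j → k ℕ.≤ j)
least P? {zero}  p = 0 , p , λ _ _ → z≤n
least P? {suc m} p with P? 0
... | yes p₀ = 0 , p₀ , λ _ _ → z≤n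
... | no ¬p₀ = let k , pₖ , k-least = least (P? ∘ suc) p in
  suc k , pₖ , λ { zero    p₀ → contradiction p₀ ¬p₀
                 ; (suc j) pⱼ → s≤s (k-least j pⱼ) }

-- Reduces an order relation over all rationals to a single one. Openness of `U x` yields a `q < b`
-- above `x`, against disjointness; conversely, locatedness decides each `q < b`.
fromℚ≤ᵣ⇔¬U : ∀ x b → fromℚ b ≤ᵣ x ⇔ (¬ U x b)
fromℚ≤ᵣ⇔¬U x b = mk⇔
  (λ b≤x u → let q , q<b , u′ = U-open x u in disjoint x (b≤x q q<b , u′))
  below
  where
  below : ¬ U x b → fromℚ b ≤ᵣ x
  below ¬u q q<b with located x q<b
  ... | inj₁ l = l
  ... | inj₂ u = contradiction u ¬u

≤ᵣfromℚ⇔¬L : ∀ x b → x ≤ᵣ fromℚ b ⇔ (¬ L x b)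
≤ᵣfromℚ⇔¬L x b = mk⇔ (λ x≤b l → <-irrefl refl (x≤b b l)) above
  where
  above : ¬ L x b → x ≤ᵣ fromℚ b
  above ¬l q l with <-cmp q b
  ... | tri< q<b _ _ = q<b
  ... | tri≈ _ q≡b _ = contradiction (subst (L x) q≡b l) ¬l
  ... | tri> _ _ b<q = contradiction (L-closed x b<q l) ¬l

-- Since `+ a / suc d` unfolds to `fromℚᵘ` of an unnormalised fraction, this moves arithmetic to
-- where `<` is plain cross-multiplication, free of gcds.
fromℚᵘ-homo-* : ∀ p q → fromℚᵘ p * fromℚᵘ q ≡ fromℚᵘ (p ℚᵘ.* q)
fromℚᵘ-homo-* p q = toℚᵘ-injective (begin-equality
  toℚᵘ (fromℚᵘ p * fromℚᵘ q)             ≃⟨ toℚᵘ-homo-* (fromℚᵘ p) (fromℚᵘ q) ⟩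
  toℚᵘ (fromℚᵘ p) ℚᵘ.* toℚᵘ (fromℚᵘ q)   ≃⟨ ℚᵘ.*-cong (toℚᵘ-fromℚᵘ p) (toℚᵘ-fromℚᵘ q) ⟩
  p ℚᵘ.* q                               ≃⟨ toℚᵘ-fromℚᵘ (p ℚᵘ.* q) ⟨
  toℚᵘ (fromℚᵘ (p ℚᵘ.* q))               ∎)
  where open ℚᵘ.≤-Reasoning

fromℚᵘ-homo-+ : ∀ p q → fromℚᵘ p + fromℚᵘ q ≡ fromℚᵘ (p ℚᵘ.+ q)
fromℚᵘ-homo-+ p q = toℚᵘ-injective (begin-equality
  toℚᵘ (fromℚᵘ p + fromℚᵘ q)             ≃⟨ toℚᵘ-homo-+ (fromℚᵘ p) (fromℚᵘ q) ⟩
  toℚᵘ (fromℚᵘ p) ℚᵘ.+ toℚᵘ (fromℚᵘ q)   ≃⟨ ℚᵘ.+-cong (toℚᵘ-fromℚᵘ p) (toℚᵘ-fromℚᵘ q) ⟩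
  p ℚᵘ.+ q                               ≃⟨ toℚᵘ-fromℚᵘ (p ℚᵘ.+ q) ⟨
  toℚᵘ (fromℚᵘ (p ℚᵘ.+ q))               ∎)
  where open ℚᵘ.≤-Reasoning

fromℚᵘ-mono-< : ∀ {p q} → p ℚᵘ.< q → fromℚᵘ p < fromℚᵘ q
fromℚᵘ-mono-< {p} {q} p<q = toℚᵘ-cancel-<
  (ℚᵘ.<-respˡ-≃ (ℚᵘ.≃-sym (toℚᵘ-fromℚᵘ p))
    (ℚᵘ.<-respʳ-≃ (ℚᵘ.≃-sym (toℚᵘ-fromℚᵘ q)) p<q))

fromℚᵘ-cancel-< : ∀ {p q} → fromℚᵘ p < fromℚᵘ q → p ℚᵘ.< q
fromℚᵘ-cancel-< {p} {q} p<q =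
  ℚᵘ.<-respˡ-≃ (toℚᵘ-fromℚᵘ p) (ℚᵘ.<-respʳ-≃ (toℚᵘ-fromℚᵘ q) (toℚᵘ-mono-< p<q))

module _ (a d m : ℕ) where
  private
    M A : ℚᵘ.ℚᵘ
    M = ℚᵘ.mkℚᵘ (+ m) 0
    A = ℚᵘ.mkℚᵘ (+ a) d

    m² : (+ m / 1) * (+ m / 1) ≡ fromℚᵘ (M ℚᵘ.* M)
    m² = fromℚᵘ-homo-* M M

    m²D : + m ℤ.* + m ℤ.* + suc d ≡ + (m ℕ.* m ℕ.* suc d)
    m²D = trans (cong (ℤ._* + suc d) (sym (ℤ.pos-* m m))) (sym (ℤ.pos-* (m ℕ.* m) (suc d)))

  -- Clear the denominator in `m² < a / (d + 1)`; the negative branch of the lower cut is void for a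
  -- natural `m`.
  L-√⇔ : L (√ (+ a / suc d)) (+ m / 1) ⇔ m ℕ.* m ℕ.* suc d ℕ.< a
  L-√⇔ = mk⇔ L⇒< <⇒L
    where
    L⇒< : L (√ (+ a / suc d)) (+ m / 1) → m ℕ.* m ℕ.* suc d ℕ.< a
    L⇒< (inj₁ m<0)
      with () ← ℤ.drop‿+<+ (subst (ℤ._< + 0) (ℤ.*-identityʳ (+ m))
                  (ℚᵘ.drop-*<* (fromℚᵘ-cancel-< {M} {ℚᵘ.0ℚᵘ} m<0)))
    L⇒< (inj₂ m²<a) = ℤ.drop‿+<+ (subst₂ ℤ._<_ m²D (ℤ.*-identityʳ (+ a))
      (ℚᵘ.drop-*<* (fromℚᵘ-cancel-< {M ℚᵘ.* M} {A} (subst (_< fromℚᵘ A) m² m²<a))))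

    <⇒L : m ℕ.* m ℕ.* suc d ℕ.< a → L (√ (+ a / suc d)) (+ m / 1)
    <⇒L m²D<a = inj₂ (subst (_< fromℚᵘ A) (sym m²) (fromℚᵘ-mono-< {M ℚᵘ.* M} {A}
      (ℚᵘ.*<* (subst₂ ℤ._<_ (sym m²D) (sym (ℤ.*-identityʳ (+ a))) (ℤ.+<+ m²D<a)))))

  U-√⇒< : U (√ (+ a / suc d)) (+ m / 1) → a ℕ.< m ℕ.* m ℕ.* suc d
  U-√⇒< (_ , a<m²) = ℤ.drop‿+<+ (subst₂ ℤ._<_ (ℤ.*-identityʳ (+ a)) m²D
    (ℚᵘ.drop-*<* (fromℚᵘ-cancel-< {A} {M ℚᵘ.* M} (subst (fromℚᵘ A <_) m² a<m²))))

  √≤ᵣfromℕᵣ⇔ : √ (+ a / suc d) ≤ᵣ fromℕᵣ m ⇔ a ℕ.≤ m ℕ.* m ℕ.* suc d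
  √≤ᵣfromℕᵣ⇔ = mk⇔
    (λ √≤m → ℕ.≮⇒≥ (to (≤ᵣfromℚ⇔¬L x (+ m / 1)) √≤m ∘ from L-√⇔))
    (λ a≤ → from (≤ᵣfromℚ⇔¬L x (+ m / 1)) (ℕ.≤⇒≯ a≤ ∘ to L-√⇔))
    where x = √ (+ a / suc d)

√≰ᵣ-[1+_] : ∀ {a} k → ¬ √ a ≤ᵣ fromℤ -[1+ k ]
√≰ᵣ-[1+_] {a} k √≤ = to (≤ᵣfromℚ⇔¬L (√ a) (-[1+ k ] / 1)) √≤
  (inj₁ (fromℚᵘ-mono-< {ℚᵘ.mkℚᵘ -[1+ k ] 0} {ℚᵘ.0ℚᵘ} (ℚᵘ.*<* ℤ.-<+)))

isCeiling-√ : ∀ {a d c} → a ℕ.≤ c ℕ.* c ℕ.* suc d →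
              (∀ k → a ℕ.≤ k ℕ.* k ℕ.* suc d → c ℕ.≤ k) →
              IsCeiling (√ (+ a / suc d)) (+ c)
isCeiling-√ {a} {d} {c} a≤ c-least = from (√≤ᵣfromℕᵣ⇔ a d c) a≤ , λ
  { (+ k)    √≤k → ℤ.+≤+ (c-least k (to (√≤ᵣfromℕᵣ⇔ a d k) √≤k))
  ; -[1+ k ] √≤z → contradiction √≤z √≰ᵣ-[1+ k ] }

-- By definition, the cuts of `(x +ᵣ 1ℚ) /ᵣ (+ 4 / 1)` test `r` by testing `4r - 1` against `x`; for
-- `r = suc s` this is a natural number.
4*suc-1 : ∀ s → + suc s / 1 * (+ 4 / 1) - 1ℚ ≡ + (3 ℕ.+ 4 ℕ.* s) / 1
4*suc-1 s = begin
  + suc s / 1 * (+ 4 / 1) - 1ℚ                 ≡⟨ cong (_- 1ℚ) (fromℚᵘ-homo-* S 4ᵘ) ⟩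
  fromℚᵘ (S ℚᵘ.* 4ᵘ) + fromℚᵘ (ℚᵘ.- ℚᵘ.1ℚᵘ)   ≡⟨ fromℚᵘ-homo-+ (S ℚᵘ.* 4ᵘ) (ℚᵘ.- ℚᵘ.1ℚᵘ) ⟩
  -- The numerator computes to `3 + s * 4 * 1`, the `-1` having cancelled one successor.
  fromℚᵘ (S ℚᵘ.* 4ᵘ ℚᵘ.- ℚᵘ.1ℚᵘ)              ≡⟨ cong (λ i → + (3 ℕ.+ i) / 1) (trans (ℕ.*-identityʳ _) (ℕ.*-comm s 4)) ⟩
  + (3 ℕ.+ 4 ℕ.* s) / 1                        ∎
  where
  open ≡-Reasoning
  S  = ℚᵘ.mkℚᵘ (+ suc s) 0
  4ᵘ = ℚᵘ.mkℚᵘ (+ 4) 0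

-- Here `r = suc s` and `E = 2 + e`; the factor `1` after the square is the denominator expected by
-- `L-√⇔`.
8n+1≡ : ∀ s e → 8 ℕ.* (suc s ℕ.* ((2 ℕ.+ e) ℕ.* s ℕ.+ 1)) ℕ.+ 1 ≡
                (3 ℕ.+ 4 ℕ.* s) ℕ.* (3 ℕ.+ 4 ℕ.* s) ℕ.* 1 ℕ.+ 8 ℕ.* e ℕ.* s ℕ.* suc s
8n+1≡ = solve-∀

n≡2[r-1]²+ : ∀ s e → suc s ℕ.* ((2 ℕ.+ e) ℕ.* s ℕ.+ 1) ≡
                     suc (s ℕ.* s ℕ.* 2 ℕ.+ (3 ℕ.* s ℕ.+ e ℕ.* s ℕ.* suc s))
n≡2[r-1]²+ = solve-∀

2r²≡n+r : ∀ s → suc s ℕ.* suc s ℕ.* 2 ≡ suc s ℕ.* (2 ℕ.* s ℕ.+ 1) ℕ.+ suc s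
2r²≡n+r = solve-∀

-- With `r = 3 + t` and `E = 3 + e`, the outer `suc` shows `n > 2r²`. For `r = 2` and `E = 3` both
-- sides would equal 8, whence the bound `r ≥ 3`.
n≡2r²+ : ∀ t e → (3 ℕ.+ t) ℕ.* ((3 ℕ.+ e) ℕ.* (2 ℕ.+ t) ℕ.+ 1) ≡
  suc ((3 ℕ.+ t) ℕ.* (3 ℕ.+ t) ℕ.* 2
       ℕ.+ (t ℕ.* t ℕ.+ 4 ℕ.* t ℕ.+ 2 ℕ.+ e ℕ.* (2 ℕ.+ t) ℕ.* (3 ℕ.+ t)))
n≡2r²+ = solve-∀

sqrt-bound : ∀ {n r E} → 2 ℕ.≤ r → 2 ℕ.≤ E → n ≡ r ℕ.* (E ℕ.* (r ℕ.∸ 1) ℕ.+ 1) →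
  let bound = (√ (+ (8 ℕ.* n ℕ.+ 1) / 1) +ᵣ 1ℚ) /ᵣ (+ 4 / 1) in
  fromℕᵣ r ≤ᵣ bound × (fromℕᵣ r ≈ᵣ bound ⇔ E ≡ 2)
sqrt-bound {n} {suc s@(suc _)} {suc (suc e)} (s≤s (s≤s _)) (s≤s (s≤s _)) refl =
  r≤bound , mk⇔ (λ r≈bound → E≡2 e (proj₂ r≈bound)) (λ E≡2 → r≤bound , bound≤r E≡2)
  where
  x     = √ (+ (8 ℕ.* n ℕ.+ 1) / 1)
  bound = (x +ᵣ 1ℚ) /ᵣ (+ 4 / 1)
  m     = 3 ℕ.+ 4 ℕ.* s

  r≤bound : fromℕᵣ (suc s) ≤ᵣ bound
  r≤bound = from (fromℚ≤ᵣ⇔¬U bound (+ suc s / 1)) λ u → ℕ.≤⇒≯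
    (subst (m ℕ.* m ℕ.* 1 ℕ.≤_) (sym (8n+1≡ s e)) (ℕ.m≤m+n _ _))
    (U-√⇒< (8 ℕ.* n ℕ.+ 1) 0 m (subst (U x) (4*suc-1 s) u))

  bound≤r : 2 ℕ.+ e ≡ 2 → bound ≤ᵣ fromℕᵣ (suc s)
  bound≤r refl = from (≤ᵣfromℚ⇔¬L bound (+ suc s / 1)) λ l → ℕ.<⇒≱
    (to (L-√⇔ (8 ℕ.* n ℕ.+ 1) 0 m) (subst (L x) (4*suc-1 s) l))
    (ℕ.≤-reflexive (trans (8n+1≡ s 0) (ℕ.+-identityʳ _)))

  E≡2 : ∀ e → let y = √ (+ (8 ℕ.* (suc s ℕ.* ((2 ℕ.+ e) ℕ.* s ℕ.+ 1)) ℕ.+ 1) / 1) in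
        (y +ᵣ 1ℚ) /ᵣ (+ 4 / 1) ≤ᵣ fromℕᵣ (suc s) → 2 ℕ.+ e ≡ 2
  E≡2 zero     _       = refl
  -- For `E ≥ 3` the excess `8 (E - 2) r (r - 1)` is positive, so `r` lies in the lower cut of the
  -- bound.
  E≡2 e@(suc _) bound≤ = contradiction
    (subst (L y) (sym (4*suc-1 s)) (from (L-√⇔ a 0 m)
      (subst (m ℕ.* m ℕ.* 1 ℕ.<_) (sym (8n+1≡ s e)) (ℕ.m<m+n (m ℕ.* m ℕ.* 1) ℕ.z<s))))
    (to (≤ᵣfromℚ⇔¬L ((y +ᵣ 1ℚ) /ᵣ (+ 4 / 1)) (+ suc s / 1)) bound≤)
    where
    a = 8 ℕ.* (suc s ℕ.* ((2 ℕ.+ e) ℕ.* s ℕ.+ 1)) ℕ.+ 1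
    y = √ (+ a / 1)

ceiling-bound : ∀ {n r E} → 3 ℕ.≤ r → 2 ℕ.≤ E → n ≡ r ℕ.* (E ℕ.* (r ℕ.∸ 1) ℕ.+ 1) →
  ∃[ c ] IsCeiling (√ (+ n / 2)) c × + r ℤ.≤ c × (+ r ≡ c ⇔ E ≡ 2)
ceiling-bound {n} {suc s@(suc (suc t))} {suc (suc e)} (s≤s (s≤s (s≤s _))) (s≤s (s≤s _)) refl
  -- `k` is at least the root of `n / 2` exactly when `n ≤ 2k²`; `k = n` is a crude starting
  -- witness, as `n` is positive.
  with least {λ k → n ℕ.≤ k ℕ.* k ℕ.* 2} (λ k → n ℕ.≤? k ℕ.* k ℕ.* 2) {n} n≤n²2
  where
  n≤n²2 : n ℕ.≤ n ℕ.* n ℕ.* 2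
  n≤n²2 = ℕ.≤-trans (ℕ.m≤m*n n n) (ℕ.m≤m*n (n ℕ.* n) 2)
... | c , n≤2c² , c-least =
  + c , isCeiling-√ n≤2c² c-least , ℤ.+≤+ r≤c
      , mk⇔ (λ { refl → E≡2 e n≤2c² })
            -- For `E = 2`, `n + r = 2r²` makes `r` a candidate, so minimality gives `c ≤ r`.
            (λ { refl → cong +_ (ℕ.≤-antisym r≤c (c-least (suc s)
              (subst (n ℕ.≤_) (sym (2r²≡n+r s)) (ℕ.m≤m+n n (suc s))))) })
  where
  -- Otherwise `c ≤ r - 1`, and `n ≤ 2c² ≤ 2(r - 1)² < n`.
  r≤c : suc s ℕ.≤ c
  r≤c = ℕ.≮⇒≥ λ { (s≤s c≤s) → ℕ.<⇒≱
    (subst (s ℕ.* s ℕ.* 2 ℕ.<_) (sym (n≡2[r-1]²+ s e)) (s≤s (ℕ.m≤m+n _ _)))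
    (ℕ.≤-trans n≤2c² (ℕ.*-monoˡ-≤ 2 (ℕ.*-mono-≤ c≤s c≤s))) }

  E≡2 : ∀ e → suc s ℕ.* ((2 ℕ.+ e) ℕ.* s ℕ.+ 1) ℕ.≤ suc s ℕ.* suc s ℕ.* 2 → 2 ℕ.+ e ≡ 2
  E≡2 zero    _    = refl
  E≡2 (suc e) n≤2r² = contradiction n≤2r² (ℕ.<⇒≱
    (subst (suc s ℕ.* suc s ℕ.* 2 ℕ.<_) (sym (n≡2r²+ t e)) (s≤s (ℕ.m≤m+n _ _))))

module _ (K : KorseltNumber) where
  open KorseltNumber K

  -- Oddness enters here: it rules out `r = 2`.
  3≤r : 3 ℕ.≤ r
  3≤r = ℕ.≤∧≢⇒< (1<p _) λ 2≡r → odd (fromℕ d-1) (subst (2 ∣_) 2≡r ∣-refl)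

  -- Makes the truncated subtraction in `n / r ∸ 1` exact, so that `E-exact` can be solved for `n`.
  1≤n/r : 1 ℕ.≤ n ℕ./ r
  1≤n/r = ℕ.n≢0⇒n>0 λ n/r≡0 → ℕ.<⇒≢ 1≤n
    (sym (trans (sym (ℕ.m/n*n≡m r∣n)) (cong (ℕ._* r) n/r≡0)))

  n≡r[E[r-1]+1] : n ≡ r ℕ.* (E ℕ.* (r ℕ.∸ 1) ℕ.+ 1)
  n≡r[E[r-1]+1] = begin
    n                                ≡⟨ ℕ.m/n*n≡m r∣n ⟨
    n ℕ./ r ℕ.* r                    ≡⟨ ℕ.*-comm (n ℕ./ r) r ⟩
    r ℕ.* (n ℕ./ r)                  ≡⟨ cong (r ℕ.*_) (ℕ.m∸n+n≡m 1≤n/r) ⟨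
    r ℕ.* (n ℕ./ r ℕ.∸ 1 ℕ.+ 1)      ≡⟨ cong (λ k → r ℕ.* (k ℕ.+ 1)) E-exact ⟨
    r ℕ.* (E ℕ.* (r ℕ.∸ 1) ℕ.+ 1)    ∎
    where open ≡-Reasoning

theorem3p7 : (K : KorseltNumber) → let open KorseltNumber K in
    (let bound = (√ (+ (8 ℕ.* n ℕ.+ 1) / 1) +ᵣ 1ℚ) /ᵣ (+ 4 / 1) in
    fromℕᵣ r ≤ᵣ bound × (fromℕᵣ r ≈ᵣ bound ⇔ E ≡ 2))
    × (∃[ c ] IsCeiling (√ (+ n / 2)) c × + r ℤ.≤ c × (+ r ≡ c ⇔ E ≡ 2))
theorem3p7 K =
  sqrt-bound (1<p _) 2≤E (n≡r[E[r-1]+1] K) , ceiling-bound (3≤r K) 2≤E (n≡r[E[r-1]+1] K)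
  where open KorseltNumber K
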